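{- Let $f(x_1,\ldots,x_n)$ be a Boolean function of $n$ variables represented in conjunctive normal form with $m$ clauses. The number of elementary operations required to obtain the pair of $(0,1)$-matrices $((f)sM0,(f)sM1)$ does not exceed the number $c\times n\times m$ for some constant $c$.
   Context: CNF conventions. A Boolean function $f(x_1,\ldots,x_n)$ in conjunctive normal form (CNF) with $m$ clauses is given as $f=\bigwedge_{i=1}^m c_i$, each clause being a nonempty disjunction of literals $x_j^\alpha$, $j\in\{1,\ldots,n\}$, $\alpha\in\{0,1\}$, where $x_j^0=\bar x_j$, $x_j^1=x_j$. Standing assumptions: no clause contains both a variable and its negation; every variable occurs (negated or not) in some clause. Clauses are numbered and identified with their numbers. Representation. $f$ is given by the $(m\times n)$-matrix $(f)\mathrm{cnf}$ with $(f)\mathrm{cnf}(i,j)=-1$ if $\bar x_j$ is in $c_i$, $=1$ if $x_j$ is in $c_i$, and $=0$ if neither is in $c_i$. Matrices. $(f)sM0$ and $(f)sM1$ are the $(n\times m)$-matrices with $(f)sM0(i,j)=1$ if the literal $\bar x_i$ is in $c_j$ and $0$ otherwise; $(f)sM1(i,j)=1$ if the literal $x_i$ is in $c_j$ and $0$ otherwise. (They represent the special decomposition $d_nS(f)=\{(F_1^0,F_1^1),\ldots,(F_n^0,F_n^1)\}$ generated by $f$, where $F_i^\alpha$ is the set of clauses containing $x_i^\alpha$.) Elementary operations: assigning a value to a function variable or to an array element; addition and subtraction of numbers; comparison of two numbers; recognition of a literal. "Constant" means independent of $n$, $m$ and the function. -}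

module Defs where

open import Data.Bool using (Bool; true; false; if_then_else_)
open import Data.Bool.Properties using () renaming (_≟_ to _≟ᵇ_)
open import Data.Fin using (Fin; toℕ)
open import Data.Fin.Properties using () renaming (_≟_ to _≟ᶠ_)
open import Data.Integer as ℤ using (ℤ; +_; 0ℤ; 1ℤ; -1ℤ)
open import Data.List.NonEmpty using (List⁺; toList)
import Data.List.Membership.DecPropositional as DecMembership
open import Data.List.Membership.Propositional using (_∈_)
open import Data.Nat as ℕ using (ℕ; suc; _+_)
open import Data.Product using (_×_; _,_; ∃-syntax)
open import Data.Product.Properties using (≡-dec)
open import Relation.Binary.Definitions using (DecidableEquality)
open import Relation.Binary.PropositionalEquality using (_≡_)
open import Relation.Nullary using (¬_; Dec; does)

-- (j , α) is the literal x_j^α, i.e. x_j for α = true and its negation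
-- for α = false.
Literal : ℕ → Set
Literal n = Fin n × Bool

_≟ˡ_ : ∀ {n} → DecidableEquality (Literal n)
_≟ˡ_ = ≡-dec _≟ᶠ_ _≟ᵇ_

Clause : ℕ → Set
Clause n = List⁺ (Literal n)

_∈ᶜ_ : ∀ {n} → Literal n → Clause n → Set
l ∈ᶜ c = l ∈ toList c

_∈ᶜ?_ : ∀ {n} (l : Literal n) (c : Clause n) → Dec (l ∈ᶜ c)
_∈ᶜ?_ {n} l c = l ∈? toList c
  where open DecMembership (_≟ˡ_ {n}) using (_∈?_)

record CNF (n m : ℕ) : Set where
  field
    clause     : Fin m → Clause n
    consistent : ∀ i j → ¬ ((j , false) ∈ᶜ clause i × (j , true) ∈ᶜ clause i)
    occurs     : ∀ j → ∃[ i ] ∃[ α ] (j , α) ∈ᶜ clause i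

open CNF public

Matrix : ℕ → ℕ → Set
Matrix r c = Fin r → Fin c → ℤ

cnf : ∀ {n m} → CNF n m → Matrix m n
cnf f i j =
  if does ((j , false) ∈ᶜ? clause f i) then -1ℤ else
  if does ((j , true)  ∈ᶜ? clause f i) then 1ℤ  else 0ℤ

sM : ∀ {n m} → Bool → CNF n m → Matrix n m
sM α f i j = if does ((i , α) ∈ᶜ? clause f j) then 1ℤ else 0ℤ

sM0 sM1 : ∀ {n m} → CNF n m → Matrix n m
sM0 = sM false
sM1 = sM true

-- Algorithms are programs of a small imperative language over integer
-- variables and two-dimensional integer arrays.  A program is a finite
-- syntactic object that cannot depend on n, m or the input function.

Var Array : Set
Var   = ℕ
Array = ℕ

infixl 6 _⊕_ _⊖_
infix  4 _==_ _≼_ _≺_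
infix  3 _≔_ _[_,_]≔_
infixr 2 _⨾_

data Expr : Set where
  con     : ℤ → Expr
  var     : Var → Expr
  _[_,_]  : Array → Expr → Expr → Expr
  _⊕_ _⊖_ : Expr → Expr → Expr

data Test : Set where
  _==_ _≼_ _≺_ : Expr → Expr → Test
  literal      : Bool → Expr → Expr → Test

data Program : Set where
  skip      : Program
  _≔_       : Var → Expr → Program
  _[_,_]≔_  : Array → Expr → Expr → Expr → Program
  _⨾_       : Program → Program → Program
  ifₚ       : Test → Program → Program → Program
  while     : Test → Program → Program

record Store : Set where
  constructor store
  field
    vars   : Var → ℤ
    arrays : Array → ℤ → ℤ → ℤ

open Store public

setVar : Var → ℤ → Store → Store
setVar x v σ = record σ
  { vars = λ y → if does (y ℕ.≟ x) then v else vars σ y }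

setEntry : Array → ℤ → ℤ → ℤ → Store → Store
setEntry a i j v σ = record σ
  { arrays = λ b k l →
      if does (b ℕ.≟ a) then
        (if does (k ℤ.≟ i) then
          (if does (l ℤ.≟ j) then v else arrays σ b k l)
         else arrays σ b k l)
      else arrays σ b k l }

numVars numClauses : Var
numVars    = 0
numClauses = 1

cnfArr sM0Arr sM1Arr : Array
cnfArr = 0
sM0Arr = 1
sM1Arr = 2

eval : Expr → Store → ℤ
eval (con v)       σ = v
eval (var x)       σ = vars σ x
eval (a [ i , j ]) σ = arrays σ a (eval i σ) (eval j σ)
eval (e ⊕ e′)      σ = eval e σ ℤ.+ eval e′ σ
eval (e ⊖ e′)      σ = eval e σ ℤ.- eval e′ σ

literalCode : Bool → ℤ
literalCode false = -1ℤ
literalCode true  = 1ℤ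

-- literal α i j recognises the literal x_j^α in the clause c_i.
test : Test → Store → Bool
test (e == e′)       σ = does (eval e σ ℤ.≟ eval e′ σ)
test (e ≼ e′)        σ = does (eval e σ ℤ.≤? eval e′ σ)
test (e ≺ e′)        σ = does (eval e σ ℤ.<? eval e′ σ)
test (literal α i j) σ =
  does (arrays σ cnfArr (eval i σ) (eval j σ) ℤ.≟ literalCode α)

-- Elementary operations, each of cost 1: assignment to a variable or to an
-- array element, addition, subtraction, comparison, literal recognition.

exprCost : Expr → ℕ
exprCost (con _)       = 0
exprCost (var _)       = 0
exprCost (_ [ i , j ]) = exprCost i + exprCost j
exprCost (e ⊕ e′)      = suc (exprCost e + exprCost e′)
exprCost (e ⊖ e′)      = suc (exprCost e + exprCost e′)

testCost : Test → ℕ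
testCost (e == e′)       = suc (exprCost e + exprCost e′)
testCost (e ≼ e′)        = suc (exprCost e + exprCost e′)
testCost (e ≺ e′)        = suc (exprCost e + exprCost e′)
testCost (literal _ i j) = suc (exprCost i + exprCost j)

-- ⟨ p , σ ⟩⇓⟨ σ′ , k ⟩: started in σ, the program p halts in σ′ after
-- exactly k elementary operations.
data ⟨_,_⟩⇓⟨_,_⟩ : Program → Store → Store → ℕ → Set where

  ⇓-skip : ∀ {σ} → ⟨ skip , σ ⟩⇓⟨ σ , 0 ⟩

  ⇓-var : ∀ {x e σ} →
    ⟨ x ≔ e , σ ⟩⇓⟨ setVar x (eval e σ) σ , suc (exprCost e) ⟩

  ⇓-entry : ∀ {a i j e σ} →
    ⟨ a [ i , j ]≔ e , σ ⟩⇓⟨ setEntry a (eval i σ) (eval j σ) (eval e σ) σ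
                           , suc (exprCost i + exprCost j + exprCost e) ⟩

  ⇓-seq : ∀ {p q σ σ′ σ″ k l} →
    ⟨ p , σ ⟩⇓⟨ σ′ , k ⟩ → ⟨ q , σ′ ⟩⇓⟨ σ″ , l ⟩ →
    ⟨ p ⨾ q , σ ⟩⇓⟨ σ″ , k + l ⟩

  ⇓-if-true : ∀ {t p q σ σ′ k} → test t σ ≡ true →
    ⟨ p , σ ⟩⇓⟨ σ′ , k ⟩ → ⟨ ifₚ t p q , σ ⟩⇓⟨ σ′ , testCost t + k ⟩

  ⇓-if-false : ∀ {t p q σ σ′ k} → test t σ ≡ false →
    ⟨ q , σ ⟩⇓⟨ σ′ , k ⟩ → ⟨ ifₚ t p q , σ ⟩⇓⟨ σ′ , testCost t + k ⟩

  ⇓-while-false : ∀ {t p σ} → test t σ ≡ false →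
    ⟨ while t p , σ ⟩⇓⟨ σ , testCost t ⟩

  ⇓-while-true : ∀ {t p σ σ′ σ″ k l} → test t σ ≡ true →
    ⟨ p , σ ⟩⇓⟨ σ′ , k ⟩ → ⟨ while t p , σ′ ⟩⇓⟨ σ″ , l ⟩ →
    ⟨ while t p , σ ⟩⇓⟨ σ″ , testCost t + k + l ⟩

-- Rows and columns of a stored matrix are numbered from 1.
Holds : ∀ {r c} → Store → Array → Matrix r c → Set
Holds σ a M = ∀ i j → arrays σ a (+ suc (toℕ i)) (+ suc (toℕ j)) ≡ M i j

-- Everything else in the initial store, including the contents of the two
-- output arrays, is arbitrary.
record Input {n m : ℕ} (f : CNF n m) (σ : Store) : Set where
  field
    n-given   : vars σ numVars ≡ + n
    m-given   : vars σ numClauses ≡ + m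
    cnf-given : Holds σ cnfArr (cnf f)

record Output {n m : ℕ} (f : CNF n m) (σ : Store) : Set where
  field
    sM0-obtained : Holds σ sM0Arr (sM0 f)
    sM1-obtained : Holds σ sM1Arr (sM1 f)

{-# OPTIONS --safe #-}
module Submission where

-- Two nested loops visit all pairs (i , j).  As no clause contains both x_i and
-- its negation, the entry (j , i) of cnf f decides the entries (i , j) of sM0
-- and sM1, with one literal recognition and one assignment each.  Together with
-- the loop overhead this costs at most 2 + n (5 + 7 m) operations, and
-- 2 + 5 n ≤ 7 n m for n, m ≥ 1.

open import Data.Bool using (Bool; true; false; if_then_else_)
open import Data.Empty using (⊥-elim)
open import Data.Fin using (Fin; zero; toℕ; fromℕ<)
open import Data.Fin.Properties using (toℕ-injective; toℕ-fromℕ<; toℕ<n)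
open import Data.Integer as ℤ using (ℤ; +_; 0ℤ; 1ℤ; -1ℤ)
import Data.Integer.Properties as ℤₚ
open import Data.Nat using (ℕ; zero; suc; _+_; _*_; _≤_; _<_; NonZero; s≤s; ≢-nonZero⁻¹)
import Data.Nat as ℕ
open import Data.Nat.Properties
open import Data.Nat.Tactic.RingSolver using (solve-∀)
open import Data.Product using (_×_; _,_; Σ-syntax; proj₁)
open import Data.Sum using (_⊎_; inj₁; inj₂)
open import Function using (_∘_)
open import Relation.Binary.PropositionalEquality
open import Relation.Nullary using (¬_; Dec; yes; no; does; contradiction)
open import Relation.Nullary.Decidable using (dec-true; dec-false)
open import Defs

-- Total-correctness triples with a cost bound.

Triple : (Store → Set) → Program → ℕ → (Store → Set) → Set
Triple P p K Q = ∀ σ → P σ →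
  Σ[ σ′ ∈ Store ] Σ[ k ∈ ℕ ] (⟨ p , σ ⟩⇓⟨ σ′ , k ⟩ × Q σ′ × k ≤ K)

seq-rule : ∀ {P Q R p q K L} →
  Triple P p K Q → Triple Q q L R → Triple P (p ⨾ q) (K + L) R
seq-rule tp tq σ pre with tp σ pre
... | σ₁ , _ , run₁ , mid , le₁ with tq σ₁ mid
... | σ₂ , _ , run₂ , post , le₂ =
  σ₂ , _ , ⇓-seq run₁ run₂ , post , +-mono-≤ le₁ le₂

consequence : ∀ {P P′ Q Q′ p K} → (∀ {σ} → P′ σ → P σ) → (∀ {σ} → Q σ → Q′ σ) →
  Triple P p K Q → Triple P′ p K Q′
consequence pre post t σ P′σ with t σ (pre P′σ)
... | σ′ , k , run , Qσ′ , le = σ′ , k , run , post Qσ′ , le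

-- Counting loops.

step : Var → Program → Program
step x body = x ≔ var x ⊕ con 1ℤ ⨾ body

-- The counter starts at 0 and is incremented before the body, so the body sees the values 1 to N,
-- which are the indices of stored matrices.
for : Var → Var → Program → Program
for x b body = x ≔ con 0ℤ ⨾ while (var x ≺ var b) (step x body)

-- One operation initialises the counter. Each round adds a comparison, an addition and an
-- assignment to `K`, and the last comparison leaves the loop.
for-cost : ℕ → ℕ → ℕ
for-cost N K = suc (N * (3 + K) + 1)

setVar-written : ∀ x v σ → vars (setVar x v σ) x ≡ v
setVar-written x v σ rewrite dec-true (x ℕ.≟ x) refl = refl

module _ {x b : Var} {body : Program} {N K : ℕ} (I : ℕ → Store → Set)
  (I-bound  : ∀ {k σ} → I k σ → vars σ b ≡ + N)
  (I-stable : ∀ {k σ} v → I k σ → I k (setVar x v σ))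
  (body-rule : ∀ (k : Fin N) →
    Triple (λ σ → I (toℕ k) σ × vars σ x ≡ + suc (toℕ k)) body K
           (λ σ → I (suc (toℕ k)) σ × vars σ x ≡ + suc (toℕ k)))
  where

  -- Induction on the number `d` of remaining rounds, which also yields termination.
  while-rule : ∀ d k → d + k ≡ N →
    Triple (λ σ → I k σ × vars σ x ≡ + k) (while (var x ≺ var b) (step x body))
           (d * (3 + K) + 1) (I N)
  while-rule zero k refl σ (inv , x≡k) =
    σ , _ , ⇓-while-false exit , inv , ≤-refl
    where
    exit : does (vars σ x ℤ.<? vars σ b) ≡ false
    exit rewrite x≡k | I-bound inv = dec-false (+ k ℤ.<? + k) (ℤₚ.<-irrefl refl)
  while-rule (suc d) k d+k≡N σ (inv , x≡k)
    with k<N ← subst (k <_) d+k≡N (s≤s (m≤n+m k d))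
    with body-rule (fromℕ< k<N) (setVar x (vars σ x ℤ.+ 1ℤ) σ) (start (toℕ-fromℕ< k<N))
    where
    -- `k′` is kept general because `toℕ (fromℕ< k<N)` equals `k` only propositionally.
    start : ∀ {k′} → k′ ≡ k → let σ₁ = setVar x (vars σ x ℤ.+ 1ℤ) σ in
      I k′ σ₁ × vars σ₁ x ≡ + suc k′
    start refl = I-stable _ inv , trans (setVar-written x _ σ)
      (trans (cong (ℤ._+ 1ℤ) x≡k) (cong +_ (+-comm k 1)))
  ... | σ₂ , _ , run , (inv₂ , x≡₂) , le
    rewrite toℕ-fromℕ< k<N
    with while-rule d (suc k) (trans (+-suc d k) d+k≡N) σ₂ (inv₂ , x≡₂)
  ... | σ₃ , _ , run′ , post , le′ =
    σ₃ , _ , ⇓-while-true enter (⇓-seq ⇓-var run) run′ , post ,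
    ≤-trans (s≤s (s≤s (s≤s (+-mono-≤ le le′))))
            (≤-reflexive (sym (+-assoc (3 + K) (d * (3 + K)) 1)))
    where
    enter : does (vars σ x ℤ.<? vars σ b) ≡ true
    enter rewrite x≡k | I-bound inv =
      dec-true (+ k ℤ.<? + N) (ℤ.+<+ k<N)

  for-rule : Triple (I 0) (for x b body) (for-cost N K) (I N)
  for-rule σ inv
    with while-rule N 0 (+-identityʳ N) (setVar x 0ℤ σ) (I-stable _ inv , setVar-written x _ σ)
  ... | σ′ , _ , run , post , le = σ′ , _ , ⇓-seq ⇓-var run , post , s≤s le

-- Reading an array after an update.

if-lookup : ∀ {A : Set} (A? : Dec A) {x y w : ℤ} →
  (A → x ≡ w) → (¬ A → y ≡ w) → (if does A? then x else y) ≡ w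
if-lookup (yes a) x≡w y≡w = x≡w a
if-lookup (no ¬a) x≡w y≡w = y≡w ¬a

setEntry-lookup : ∀ a k l v σ {b k′ l′ w} →
  (b ≡ a → k′ ≡ k → l′ ≡ l → v ≡ w) →
  (¬ (b ≡ a × k′ ≡ k × l′ ≡ l) → arrays σ b k′ l′ ≡ w) →
  arrays (setEntry a k l v σ) b k′ l′ ≡ w
setEntry-lookup a k l _ _ {b} {k′} {l′} new old =
  if-lookup (b ℕ.≟ a)
    (λ b≡a → if-lookup (k′ ℤ.≟ k)
      (λ k′≡k → if-lookup (l′ ℤ.≟ l)
        (new b≡a k′≡k)
        (λ l′≢l → old λ (_ , _ , l′≡l) → l′≢l l′≡l))
      (λ k′≢k → old λ (_ , k′≡k , _) → k′≢k k′≡k))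
    (λ b≢a → old λ (b≡a , _) → b≢a b≡a)

output : Bool → Array
output false = sM0Arr
output true  = sM1Arr

output-injective : ∀ {α β} → output α ≡ output β → α ≡ β
output-injective {false} {false} _ = refl
output-injective {true}  {true}  _ = refl

cnfArr≢output : ∀ α → ¬ cnfArr ≡ output α
cnfArr≢output false ()
cnfArr≢output true  ()

index-injective : ∀ {n} {i j : Fin n} → + suc (toℕ i) ≡ + suc (toℕ j) → i ≡ j
index-injective eq = toℕ-injective (suc-injective (ℤₚ.+-injective eq))

-- The program and the decoding of the input.

row col : Var
row = 2
col = 3

-- The indices are swapped between test and assignment: clauses are the rows of the input matrix but
-- the columns of both outputs.
recordLiteral : Bool → Program
recordLiteral α = ifₚ (literal α (var col) (var row))
  (output α [ var row , var col ]≔ con 1ℤ)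
  (output α [ var row , var col ]≔ con 0ℤ)

extractMatrices : Program
extractMatrices =
  for row numVars (for col numClauses (recordLiteral false ⨾ recordLiteral true))

-- The encoding asks for the negated literal first, so with both literals present the code -1 would
-- hide the positive one; `¬ (A × B)` excludes this case.
decode-entry : ∀ {A B : Set} (A? : Dec A) (B? : Dec B) → ¬ (A × B) → ∀ α →
  does ((if does A? then -1ℤ else if does B? then 1ℤ else 0ℤ) ℤ.≟ literalCode α) ≡
  (if α then does B? else does A?)
decode-entry (yes a) (yes b) ¬ab _     = contradiction (a , b) ¬ab
decode-entry (yes _) (no _)  _   false = refl
decode-entry (yes _) (no _)  _   true  = refl
decode-entry (no _)  (yes _) _   false = refl
decode-entry (no _)  (yes _) _   true  = refl
decode-entry (no _)  (no _)  _   false = refl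
decode-entry (no _)  (no _)  _   true  = refl

module _ {n m : ℕ} (f : CNF n m) where

  cnf-recognises : ∀ α i j →
    does (cnf f j i ℤ.≟ literalCode α) ≡ does ((i , α) ∈ᶜ? clause f j)
  -- Splitting on the sign lets the conditional on `α` in `decode-entry` reduce.
  cnf-recognises false i j = decode-entry
    ((i , false) ∈ᶜ? clause f j) ((i , true) ∈ᶜ? clause f j) (consistent f j i) false
  cnf-recognises true i j = decode-entry
    ((i , false) ∈ᶜ? clause f j) ((i , true) ∈ᶜ? clause f j) (consistent f j i) true

  -- The invariant and its preservation.

  Region : Set₁
  Region = Bool → Fin n → Fin m → Set

  -- Nothing is claimed about output entries outside `D`, since their initial contents are
  -- arbitrary.
  record Progress (D : Region) (σ : Store) : Set where
    field
      input   : Input f σ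
      correct : ∀ {α i j} → D α i j →
        arrays σ (output α) (+ suc (toℕ i)) (+ suc (toℕ j)) ≡ sM α f i j

  open Progress
  open Input

  weaken : ∀ {D D′ : Region} {σ} → (∀ {α i j} → D′ α i j → D α i j) →
    Progress D σ → Progress D′ σ
  weaken D′⊆D pr .input   = pr .input
  weaken D′⊆D pr .correct = pr .correct ∘ D′⊆D

  setVar-progress : ∀ {D x v σ} → ¬ numVars ≡ x → ¬ numClauses ≡ x →
    Progress D σ → Progress D (setVar x v σ)
  setVar-progress {x = x} ≢n ≢m pr = record
    { input = record
        { n-given   = if-lookup (numVars ℕ.≟ x) (⊥-elim ∘ ≢n) λ _ → n-given (input pr)
        ; m-given   = if-lookup (numClauses ℕ.≟ x) (⊥-elim ∘ ≢m) λ _ → m-given (input pr)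
        ; cnf-given = cnf-given (input pr)
        }
    ; correct = correct pr
    }

  _∪⟨_,_,_⟩ : Region → Bool → Fin n → Fin m → Region
  (D ∪⟨ α₀ , i₀ , j₀ ⟩) α i j = D α i j ⊎ (α ≡ α₀ × i ≡ i₀ × j ≡ j₀)

  setEntry-progress : ∀ {D σ} α i j → Progress D σ →
    Progress (D ∪⟨ α , i , j ⟩)
      (setEntry (output α) (+ suc (toℕ i)) (+ suc (toℕ j)) (sM α f i j) σ)
  setEntry-progress {D} {σ} α i j pr = record
    { input = record
        { n-given   = n-given (input pr)
        ; m-given   = m-given (input pr)
        ; cnf-given = λ j′ i′ → setEntry-lookup _ (+ suc (toℕ i)) (+ suc (toℕ j)) (sM α f i j) σ
            (⊥-elim ∘ cnfArr≢output α) (λ _ → cnf-given (input pr) j′ i′)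
        }
    ; correct = λ d → setEntry-lookup (output α) (+ suc (toℕ i)) (+ suc (toℕ j)) _ σ agree (old d)
    }
    where
    agree : ∀ {α′ i′ j′} → output α′ ≡ output α → + suc (toℕ i′) ≡ + suc (toℕ i) →
      + suc (toℕ j′) ≡ + suc (toℕ j) → sM α f i j ≡ sM α′ f i′ j′
    agree p q r rewrite output-injective p | index-injective q | index-injective r = refl
    -- An entry left untouched must come from `D`, because the entry added to the region is the one
    -- overwritten.
    old : ∀ {α′ i′ j′} → (D ∪⟨ α , i , j ⟩) α′ i′ j′ →
      ¬ (output α′ ≡ output α × + suc (toℕ i′) ≡ + suc (toℕ i) ×
         + suc (toℕ j′) ≡ + suc (toℕ j)) →
      arrays σ (output α′) (+ suc (toℕ i′)) (+ suc (toℕ j′)) ≡ sM α′ f i′ j′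
    old (inj₁ d)                    _   = correct pr d
    old (inj₂ (refl , refl , refl)) new = contradiction (refl , refl , refl) new

  -- Correctness and cost of the loops.

  At : Fin n → Fin m → Store → Set
  At i j σ = vars σ row ≡ + suc (toℕ i) × vars σ col ≡ + suc (toℕ j)

  recordLiteral-rule : ∀ {D} α i j →
    Triple (λ σ → Progress D σ × At i j σ) (recordLiteral α) 2
           (λ σ → Progress (D ∪⟨ α , i , j ⟩) σ × At i j σ)
  recordLiteral-rule {D} α i j σ (pr , row≡ , col≡) =
    _ , 2 , run , (subst (Progress _) final (setEntry-progress α i j pr) , row≡ , col≡) , ≤-refl
    where
    t = literal α (var col) (var row)

    -- A single conditional value describes the result of both branches.
    σ′ = setEntry (output α) (vars σ row) (vars σ col) (if test t σ then 1ℤ else 0ℤ) σ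

    run : ⟨ recordLiteral α , σ ⟩⇓⟨ σ′ , 2 ⟩
    run with test t σ in eq
    ... | true  = ⇓-if-true eq ⇓-entry
    ... | false = ⇓-if-false eq ⇓-entry

    final : setEntry (output α) (+ suc (toℕ i)) (+ suc (toℕ j)) (sM α f i j) σ ≡ σ′
    -- After these rewrites the tested value is the membership decision that defines `sM`.
    final rewrite row≡ | col≡ | cnf-given (input pr) j i | cnf-recognises α i j = refl

  RowsBelow : ℕ → Region
  RowsBelow k _ i _ = toℕ i < k

  -- The positions lexicographically before `(k , l)`, for both signs: the order in which the nested
  -- loops visit them.
  EntriesBefore : ℕ → ℕ → Region
  EntriesBefore k l _ i j = toℕ i < k ⊎ (toℕ i ≡ k × toℕ j < l)

  entry-rule : ∀ i j →
    Triple (λ σ → Progress (EntriesBefore (toℕ i) (toℕ j)) σ × At i j σ)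
           (recordLiteral false ⨾ recordLiteral true) 4
           (λ σ → Progress (EntriesBefore (toℕ i) (suc (toℕ j))) σ × At i j σ)
  entry-rule i j = consequence (λ pre → pre) (λ (pr , at) → weaken covered pr , at)
    (seq-rule (recordLiteral-rule false i j) (recordLiteral-rule true i j))
    where
    covered : ∀ {α i′ j′} → EntriesBefore (toℕ i) (suc (toℕ j)) α i′ j′ →
      ((EntriesBefore (toℕ i) (toℕ j) ∪⟨ false , i , j ⟩) ∪⟨ true , i , j ⟩) α i′ j′
    covered (inj₁ i′<i) = inj₁ (inj₁ (inj₁ i′<i))
    -- In the current column, each sign is covered by its own assignment.
    covered {α} (inj₂ (i′≡i , j′≤j)) with m<1+n⇒m<n∨m≡n j′≤j
    ... | inj₁ j′<j = inj₁ (inj₁ (inj₂ (i′≡i , j′<j)))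
    covered {false} (inj₂ (i′≡i , _)) | inj₂ j′≡j =
      inj₁ (inj₂ (refl , toℕ-injective i′≡i , toℕ-injective j′≡j))
    covered {true} (inj₂ (i′≡i , _)) | inj₂ j′≡j =
      inj₂ (refl , toℕ-injective i′≡i , toℕ-injective j′≡j)

  row-rule : ∀ i →
    Triple (λ σ → Progress (RowsBelow (toℕ i)) σ × vars σ row ≡ + suc (toℕ i))
           (for col numClauses (recordLiteral false ⨾ recordLiteral true))
           (for-cost m 4)
           (λ σ → Progress (RowsBelow (suc (toℕ i))) σ × vars σ row ≡ + suc (toℕ i))
  row-rule i = consequence
    -- No column lies below 0, so the inner loop starts with complete rows only; at its end every
    -- column lies below `m`, and row `i` is complete too.
    (λ (pr , row≡) → weaken (λ { (inj₁ i′<i) → i′<i }) pr , row≡)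
    (λ (pr , row≡) → weaken (λ {α} → covered {α}) pr , row≡)
    (for-rule
      (λ l σ → Progress (EntriesBefore (toℕ i) l) σ × vars σ row ≡ + suc (toℕ i))
      (λ (pr , _) → m-given (input pr))
      (λ _ (pr , row≡) → setVar-progress (λ ()) (λ ()) pr , row≡)
      (λ j → consequence (λ ((pr , row≡) , col≡) → pr , row≡ , col≡)
                         (λ (pr , row≡ , col≡) → (pr , row≡) , col≡)
                         (entry-rule i j)))
    where
    covered : ∀ {α i′ j′} → RowsBelow (suc (toℕ i)) α i′ j′ →
      EntriesBefore (toℕ i) m α i′ j′
    covered {j′ = j′} i′≤i with m<1+n⇒m<n∨m≡n i′≤i
    ... | inj₁ i′<i = inj₁ i′<i
    ... | inj₂ i′≡i = inj₂ (i′≡i , toℕ<n j′)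

  extractMatrices-rule :
    Triple (Input f) extractMatrices (for-cost n (for-cost m 4)) (Output f)
  extractMatrices-rule = consequence
    -- No row lies below 0, so the initial region is empty.
    (λ inp → record { input = inp ; correct = λ () })
    (λ pr → record { sM0-obtained = λ i j → correct pr (toℕ<n i)
                   ; sM1-obtained = λ i j → correct pr (toℕ<n i) })
    (for-rule (λ k → Progress (RowsBelow k))
      (λ pr → n-given (input pr))
      (λ _ → setVar-progress (λ ()) (λ ()))
      row-rule)

-- The numerical bound.

for-cost-bound : ∀ n m → for-cost (suc n) (for-cost (suc m) 4) ≤ 14 * suc n * suc m
for-cost-bound n m = m+n≤o⇒m≤o _ (≤-reflexive (slack n m))
  where
  -- With `N = suc n` and `M = suc m`, the difference `7NM - 5N - 2` between bound and cost becomes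
  -- `7Nm + 2n`, which has no negative terms.
  slack : ∀ n m → suc (suc n * (3 + suc (suc m * 7 + 1)) + 1) + (7 * (suc n * m) + 2 * n) ≡
    14 * suc n * suc m
  slack = solve-∀

-- The linear terms of the cost are absorbed because m > 0: each of the
-- n > 0 variables occurs in some clause.
extraction-cost-bound : ∀ n m → .{{_ : NonZero n}} → CNF n m →
  for-cost n (for-cost m 4) ≤ 14 * n * m
extraction-cost-bound zero    _ {{nz}} _ = contradiction refl (≢-nonZero⁻¹ 0 {{nz}})
extraction-cost-bound (suc n) (suc m) _ = for-cost-bound n m
extraction-cost-bound (suc n) zero    f with () ← proj₁ (occurs f zero)

proposition5p3 : Σ[ p ∈ Program ] Σ[ c ∈ ℕ ]
    (∀ (n m : ℕ) → .{{_ : NonZero n}} → (f : CNF n m) (σ : Store) → Input f σ →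
    Σ[ σ′ ∈ Store ] Σ[ k ∈ ℕ ]
    (⟨ p , σ ⟩⇓⟨ σ′ , k ⟩ × Output f σ′ × k ≤ c * n * m))
proposition5p3 = extractMatrices , 14 , bounded
  where
  bounded : ∀ (n m : ℕ) → .{{_ : NonZero n}} → (f : CNF n m) (σ : Store) → Input f σ →
    Σ[ σ′ ∈ Store ] Σ[ k ∈ ℕ ]
    (⟨ extractMatrices , σ ⟩⇓⟨ σ′ , k ⟩ × Output f σ′ × k ≤ 14 * n * m)
  bounded n m f σ inp with extractMatrices-rule f σ inp
  ... | σ′ , k , run , out , le =
    σ′ , k , run , out , ≤-trans le (extraction-cost-bound n m f)
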